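{- Let $G$ be a clustered graph on $mn$ vertices with clusters $C_i=\{v_{i,1},\dots,v_{i,m}\}$, $i=1,\dots,n$, and adjacency blocks $A_{i,j}$, satisfying: (1) (Commuting condition) for all $i_1,j_1,i_2,j_2\in\{1,\dots,n\}$ and $\alpha,\beta\in\{1,\dots,m\}$, $\left|\mathrm{nbd}_{C_{j_1}}(v_{i_1,\alpha})\cap \mathrm{nbd}_{C_{i_2}}(v_{j_2,\beta})\right| = \left|\mathrm{nbd}_{C_{i_1}}(v_{j_1,\beta})\cap \mathrm{nbd}_{C_{j_2}}(v_{i_2,\alpha})\right|$; (2) (Normality condition) for all $i\neq j$ and $\alpha,\beta$, the number of common neighbours in $C_j$ of $v_{i,\alpha},v_{i,\beta}$ equals the number of common neighbours in $C_i$ of $v_{j,\alpha},v_{j,\beta}$. Let $k\geq 2$ and let $H$ be a clustered graph on $km$ vertices with clusters $D_1,\dots,D_k$, each of $m$ vertices, such that each $D_p$ is a (labelled) copy of some cluster of $G$, i.e. the diagonal block of the adjacency matrix of $H$ for $D_p$ equals $A_{i,i}$ for some $i\in\{1,\dots,n\}$, and for every $p\neq q$ the block $D_{p,q}$ describing the adjacencies between $D_p$ and $D_q$ satisfies $D_{p,q}\in\{I_m,0_{m\times m}\}\cup\{A_{i,j}: i\neq j,\ 1\leq i,j\leq n\}$. Then $H$ and its graph theoretical partial transpose $H^\tau$ are cospectral.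
   Context: All graphs are finite, simple and undirected. A clustered graph with clusters $C_i=\{v_{i,1},\dots,v_{i,m}\}$, $i=1,\dots,n$, has adjacency matrix written as the block matrix $[A_{i,j}]$ with $(A_{i,j})_{\alpha\beta}=1$ iff $v_{i,\alpha}$ and $v_{j,\beta}$ are adjacent. $\mathrm{nbd}_{C_j}(v_{i,\alpha})=\{\beta : v_{i,\alpha}\sim v_{j,\beta}\}\subseteq\{1,\dots,m\}$. The graph theoretical partial transpose of a clustered graph with adjacency matrix $[A_{i,j}]$ is the graph on the same vertex set with adjacency matrix $[A_{i,j}^t]$; equivalently, edges inside clusters and edges $(v_{i,k},v_{j,k})$ are kept and each edge $(v_{i,k},v_{j,l})$ with $i\neq j$, $k\neq l$ is replaced by $(v_{i,l},v_{j,k})$. Cospectral means equal multisets of adjacency eigenvalues. -}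

module Defs where

open import Data.Nat using (ℕ; zero; suc; _*_)
open import Data.Integer as ℤ using (ℤ; 0ℤ; 1ℤ; -_)
open import Data.Bool using (Bool; true; false; if_then_else_; _∧_)
open import Data.Fin using (Fin; zero; suc; punchIn; remQuot; _≟_)
open import Data.Product using (_×_; _,_; Σ; ∃; ∃-syntax)
open import Data.Sum using (_⊎_)
open import Data.List using (List; []; _∷_; map)
open import Relation.Nullary using (¬_; does)
open import Relation.Binary.PropositionalEquality using (_≡_)

count : {m : ℕ} → (Fin m → Bool) → ℕ
count {zero}  f = 0
count {suc m} f = (if f zero then 1 else 0) Data.Nat.+ count (λ i → f (suc i))

-- Clustered graphs: n clusters of m vertices; vertex v_{i,α} = (i , α).
-- Adj i j α β  = (A_{i,j})_{αβ} = "v_{i,α} ~ v_{j,β}".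

ClusterAdj : ℕ → ℕ → Set
ClusterAdj n m = Fin n → Fin n → Fin m → Fin m → Bool

IsSimple : {n m : ℕ} → ClusterAdj n m → Set
IsSimple {n} {m} A =
  (∀ (i j : Fin n) (α β : Fin m) → A i j α β ≡ A j i β α) ×
  (∀ (i : Fin n) (α : Fin m) → A i i α α ≡ false)

commonNbd : {n m : ℕ} → ClusterAdj n m → Fin n → Fin m → Fin n → Fin n → Fin m → Fin n → ℕ
commonNbd A i α j k β l = count (λ γ → A i j α γ ∧ A k l β γ)

CommutingCondition : {n m : ℕ} → ClusterAdj n m → Set
CommutingCondition {n} {m} A =
  ∀ (i₁ j₁ i₂ j₂ : Fin n) (α β : Fin m) →
    commonNbd A i₁ α j₁ j₂ β i₂ ≡ commonNbd A j₁ β i₁ i₂ α j₂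

NormalityCondition : {n m : ℕ} → ClusterAdj n m → Set
NormalityCondition {n} {m} A =
  ∀ (i j : Fin n) → ¬ (i ≡ j) → ∀ (α β : Fin m) →
    commonNbd A i α j i β j ≡ commonNbd A j α i j β i

partialTranspose : {n m : ℕ} → ClusterAdj n m → ClusterAdj n m
partialTranspose A i j α β = A i j β α

idBlock : {m : ℕ} → Fin m → Fin m → Bool
idBlock α β = does (α ≟ β)

BuiltFrom : {n m k : ℕ} → ClusterAdj n m → ClusterAdj k m → Set
BuiltFrom {n} {m} {k} A H =
  (∀ (p : Fin k) → ∃[ i ] (∀ (α β : Fin m) → H p p α β ≡ A i i α β)) ×
  (∀ (p q : Fin k) → ¬ (p ≡ q) →
     (∀ (α β : Fin m) → H p q α β ≡ idBlock α β)
     ⊎ (∀ (α β : Fin m) → H p q α β ≡ false)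
     ⊎ (∃[ i ] ∃[ j ] (¬ (i ≡ j) × (∀ (α β : Fin m) → H p q α β ≡ A i j α β))))

-- Polynomials over ℤ as coefficient lists (lowest degree first)

Poly : Set
Poly = List ℤ

infixl 6 _+P_
infixl 7 _*P_

_+P_ : Poly → Poly → Poly
[]      +P q       = q
p       +P []      = p
(a ∷ p) +P (b ∷ q) = (a ℤ.+ b) ∷ (p +P q)

_*P_ : Poly → Poly → Poly
[]      *P q = []
(a ∷ p) *P q = map (a ℤ.*_) q +P (0ℤ ∷ (p *P q))

negP : Poly → Poly
negP = map -_

coeff : Poly → ℕ → ℤ
coeff []      _       = 0ℤ
coeff (a ∷ p) zero    = a
coeff (a ∷ p) (suc i) = coeff p i

_≈P_ : Poly → Poly → Set
p ≈P q = ∀ (i : ℕ) → coeff p i ≡ coeff q i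

sumFin : {n : ℕ} → (Fin n → Poly) → Poly
sumFin {zero}  f = []
sumFin {suc n} f = f zero +P sumFin (λ j → negP (f (suc j)))
-- (the negation at each shift produces the alternating sign (-1)^j)

det : (N : ℕ) → (Fin N → Fin N → Poly) → Poly
det zero    M = 1ℤ ∷ []
det (suc N) M = sumFin (λ j → M zero j *P det N (λ r c → M (suc r) (punchIn j c)))

charPoly : (N : ℕ) → (Fin N → Fin N → Bool) → Poly
charPoly N A = det N (λ r c →
  let a = if A r c then 1ℤ else 0ℤ in
  if does (r ≟ c) then (- a) ∷ 1ℤ ∷ [] else (- a) ∷ [])

flatten : {k m : ℕ} → ClusterAdj k m → Fin (k * m) → Fin (k * m) → Bool
flatten {k} {m} H x y with remQuot {k} m x | remQuot {k} m y
... | p , α | q , β = H p q α β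

Cospectral : {k m : ℕ} → ClusterAdj k m → ClusterAdj k m → Set
Cospectral {k} {m} H H' = charPoly (k * m) (flatten H) ≈P charPoly (k * m) (flatten H')

{-# OPTIONS --safe #-}

-- The commuting condition makes all blocks of H commute pairwise.  Hence, by induction on e, the
-- (p , q) block of the e-th power of H^τ is the (q , p) block of the e-th power of H, so
-- the two adjacency matrices have equal power traces.  Newton's identities recover the
-- characteristic polynomial p from these traces.  They come from the cofactors C of x I - A
-- in ℤ[[x]]: the relation (x I - A) C = p I steps between consecutive coefficients of C,
-- and Jacobi's formula for x d/dx gives i p_i = N p_i + tr (A C_i).
module Submission where

open import Defs
open import Data.Nat using (ℕ; _≥_)
open import Algebra.Bundles using (CommutativeRing)
import Algebra.Properties.Semiring.Sum as Sum
open import Data.Bool using (Bool; true; false; if_then_else_; _∧_)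
open import Data.Fin using
  (Fin; zero; suc; punchIn; pinch; _↑ˡ_; _↑ʳ_; combine; _≟_)
open import Data.Fin.Properties using (remQuot-combine)
import Data.Integer.Properties as ℤ
open import Data.Integer.Tactic.RingSolver using (solve-∀)
open import Data.List using ([]; _∷_; map)
open import Data.Nat as ℕ using (zero; suc; s≤s)
import Data.Nat.Properties as ℕ
open import Data.Product using (_×_; _,_; ∃₂; proj₁; proj₂)
open import Data.Sum using (_⊎_; inj₁; inj₂)
open import Data.Vec.Functional using (updateAt)
open import Data.Vec.Functional.Properties using
  (updateAt-updates; updateAt-minimal; updateAt-id-local; updateAt-commutes; map-updateAt)
open import Function using (_∘_; _∘′_; const)
open import Level using (0ℓ)
open import Relation.Nullary using (yes; no; contradiction; does)
import Relation.Binary.PropositionalEquality as ≡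
open ≡ using (_≡_; _≢_)

-- Because `H` is symmetric, transposing each block in place is the same as moving block (p , q) to
-- position (q , p). Multiplying the moved blocks produces the block products with their factors
-- reversed, and commutativity restores the order. Position (p , p) does not move, so the diagonal
-- blocks of corresponding powers coincide and the traces agree.
--
-- The passage from traces to coefficients uses no eigenvalues and no division: it needs only that a
-- nonzero factor i - N can be cancelled in ℤ. It descends from index N + 1, where all coefficients
-- vanish. At i = N the factor is zero, and the leading coefficients have to be compared directly.
--
-- Power series are functions compared pointwise, which is what `≈P` asks of the coefficients; the
-- price is that degree bounds need lemmas of their own. The determinant theory is generic because
-- it serves two rings: the series for the characteristic polynomial, and ℤ for the alternating sums
-- of single coefficients.

infixl 9 _[_]≔_

_[_]≔_ : ∀ {a} {X : Set a} {n} → (Fin n → X) → Fin n → X → Fin n → X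
M [ r ]≔ v = updateAt M r (const v)

-- Choosing column j and then column k of those left picks an ordered pair of columns; `punchIn j k`
-- and `pinch k j` encode the same pair in the opposite order. Deleting both columns therefore
-- leaves the same columns either way.
punchIn-punchIn : ∀ {n} (j : Fin (suc (suc n))) (k : Fin (suc n)) (c : Fin n) →
  punchIn (punchIn j k) (punchIn (pinch k j) c) ≡ punchIn j (punchIn k c)
punchIn-punchIn zero    k       c       = ≡.refl
punchIn-punchIn (suc j) zero    c       = ≡.refl
punchIn-punchIn (suc j) (suc k) zero    = ≡.refl
punchIn-punchIn (suc j) (suc k) (suc c) = ≡.cong suc (punchIn-punchIn j k c)

punchIn-pinch : ∀ {n} (j : Fin (suc (suc n))) (k : Fin (suc n)) →
  punchIn (punchIn j k) (pinch k j) ≡ j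
punchIn-pinch zero    k    = ≡.refl
punchIn-pinch (suc j) zero = ≡.refl
punchIn-pinch {suc n} (suc j) (suc k) = ≡.cong suc (punchIn-pinch j k)

-- Determinants over a commutative ring

module Determinant {c ℓ} (R : CommutativeRing c ℓ) where

  open CommutativeRing R hiding (zero)
  open import Algebra.Properties.Semiring.Sum semiring
  open import Algebra.Properties.Ring ring
  open import Algebra.Solver.Ring.NaturalCoefficients.Default commutativeSemiring
    using (solve; _:=_; _:+_; _:*_; con)
  open import Relation.Binary.Reasoning.Setoid setoid

  Matrix : ℕ → Set c
  Matrix N = Fin N → Fin N → Carrier

  -- Opaque so that unification can recover f from alt f.
  opaque
    alt : ∀ {n} → (Fin n → Carrier) → Carrier
    alt {zero}  f = 0#
    alt {suc n} f = f zero - alt (f ∘ suc)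

    alt-[] : (f : Fin zero → Carrier) → alt f ≈ 0#
    alt-[] f = refl

    alt-∷ : ∀ {n} (f : Fin (suc n) → Carrier) → alt f ≈ f zero - alt (f ∘ suc)
    alt-∷ f = refl

    alt-cong : ∀ {n} {f g : Fin n → Carrier} → (∀ j → f j ≈ g j) → alt f ≈ alt g
    alt-cong {zero}  f≈g = refl
    alt-cong {suc n} f≈g = +-cong (f≈g zero) (-‿cong (alt-cong (f≈g ∘ suc)))

  minor : ∀ {N} → Matrix (suc N) → Fin (suc N) → Matrix N
  minor M j r c = M (suc r) (punchIn j c)

  determinant : ∀ N → Matrix N → Carrier
  determinant zero    M = 1#
  determinant (suc N) M = alt (λ j → M zero j * determinant N (minor M j))

  -- Scaling and addition share one induction: a = 1 gives `alt-+`, g = 0 gives `alt-*`, and a = -1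
  -- splits off a first summand. `det-linear` has the same form.
  alt-linear : ∀ {n} a (f g : Fin n → Carrier) →
    alt (λ j → a * f j + g j) ≈ a * alt f + alt g
  alt-linear {zero}  a f g = begin
    alt _                ≈⟨ alt-[] _ ⟩
    0#                   ≈⟨ trans (+-identityʳ _) (zeroʳ a) ⟨
    a * 0# + 0#          ≈⟨ +-cong (*-congˡ (alt-[] f)) (alt-[] g) ⟨
    a * alt f + alt g    ∎
  alt-linear {suc n} a f g = begin
    alt (λ j → a * f j + g j)
      ≈⟨ alt-∷ _ ⟩
    a * f zero + g zero - alt (λ j → a * f (suc j) + g (suc j))
      ≈⟨ +-congˡ (-‿cong (alt-linear a (f ∘ suc) (g ∘ suc))) ⟩
    a * f zero + g zero - (a * p + q)
      ≈⟨ +-congˡ (trans (sym (-‿+-comm _ _)) (+-congʳ (-‿distribʳ-* a p))) ⟩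
    a * f zero + g zero + (a * - p + - q)
      ≈⟨ solve 5 (λ a x y p q → (a :* x :+ y) :+ (a :* p :+ q) := a :* (x :+ p) :+ (y :+ q))
           refl a (f zero) (g zero) (- p) (- q) ⟩
    a * (f zero - p) + (g zero - q)
      ≈⟨ +-cong (*-congˡ (alt-∷ f)) (alt-∷ g) ⟨
    a * alt f + alt g ∎
    where
    p = alt (f ∘ suc)
    q = alt (g ∘ suc)

  alt-+ : ∀ {n} (f g : Fin n → Carrier) → alt (λ j → f j + g j) ≈ alt f + alt g
  alt-+ f g = begin
    alt (λ j → f j + g j)       ≈⟨ alt-cong (λ j → +-congʳ (*-identityˡ _)) ⟨
    alt (λ j → 1# * f j + g j)  ≈⟨ alt-linear 1# f g ⟩
    1# * alt f + alt g          ≈⟨ +-congʳ (*-identityˡ _) ⟩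
    alt f + alt g               ∎

  alt-zero : ∀ {n} {f : Fin n → Carrier} → (∀ j → f j ≈ 0#) → alt f ≈ 0#
  alt-zero {zero}  f≈0 = alt-[] _
  alt-zero {suc n} f≈0 = trans (alt-∷ _) (trans (+-cong (f≈0 zero) (-‿cong (alt-zero (f≈0 ∘ suc)))) (-‿inverseʳ 0#))

  alt-* : ∀ {n} a (f : Fin n → Carrier) → alt (λ j → a * f j) ≈ a * alt f
  alt-* {n} a f = begin
    alt (λ j → a * f j)                     ≈⟨ alt-cong (λ j → +-identityʳ _) ⟨
    alt (λ j → a * f j + 0#)                ≈⟨ alt-linear a f (const 0#) ⟩
    a * alt f + alt (λ (j : Fin n) → 0#)    ≈⟨ +-congˡ (alt-zero {n} (λ _ → refl)) ⟩
    a * alt f + 0#                          ≈⟨ +-identityʳ _ ⟩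
    a * alt f                               ∎

  alt-sum : ∀ {n} m (f : Fin n → Fin m → Carrier) →
    alt (λ j → sum (f j)) ≈ sum (λ i → alt (λ j → f j i))
  alt-sum {n} zero f = alt-zero {n} (λ _ → refl)
  alt-sum (suc m) f = trans (alt-+ _ _) (+-congˡ (alt-sum m (λ j → f j ∘ suc)))

  -- Exchanging the two chosen columns flips the sign (-1)^(j+k), so the terms cancel in pairs. In
  -- the induction the terms with j = 0 cancel those with k = 0 and j > 0, and the others form the
  -- same sum one size smaller.
  alt-alt-symmetric : ∀ {n} (h : Fin (suc (suc n)) → Fin (suc n) → Carrier) →
    (∀ j k → h (punchIn j k) (pinch k j) ≈ h j k) → alt (λ j → alt (h j)) ≈ 0#
  alt-alt-symmetric {n} h h-sym = begin
    alt (λ j → alt (h j))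
      ≈⟨ alt-∷ _ ⟩
    alt (h zero) - alt (λ j → alt (h (suc j)))
      ≈⟨ +-congˡ (-‿cong (alt-cong (λ j →
           trans (alt-∷ (h (suc j))) (trans (+-comm _ _) (+-congʳ (sym (-1*x≈-x _))))))) ⟩
    alt (h zero) - alt (λ j → - 1# * alt (λ k → h (suc j) (suc k)) + h (suc j) zero)
      ≈⟨ +-congˡ (-‿cong (alt-linear (- 1#) _ _)) ⟩
    alt (h zero) - (- 1# * alt (λ j → alt (λ k → h (suc j) (suc k))) + alt (λ j → h (suc j) zero))
      ≈⟨ +-congˡ (-‿cong (+-cong (trans (*-congˡ (rest n h h-sym)) (zeroʳ _)) (alt-cong (h-sym zero)))) ⟩
    alt (h zero) - (0# + alt (h zero))
      ≈⟨ +-congˡ (-‿cong (+-identityˡ _)) ⟩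
    alt (h zero) - alt (h zero)
      ≈⟨ -‿inverseʳ _ ⟩
    0# ∎
    where
    rest : ∀ n (h : Fin (suc (suc n)) → Fin (suc n) → Carrier) →
      (∀ j k → h (punchIn j k) (pinch k j) ≈ h j k) →
      alt (λ j → alt (λ k → h (suc j) (suc k))) ≈ 0#
    rest zero    h h-sym = alt-zero (λ j → alt-[] _)
    rest (suc n) h h-sym =
      alt-alt-symmetric (λ j k → h (suc j) (suc k)) (λ j k → h-sym (suc j) (suc k))

  det-cong : ∀ N {M M′ : Matrix N} → (∀ r c → M r c ≈ M′ r c) → determinant N M ≈ determinant N M′
  det-cong zero    M≈M′ = refl
  det-cong (suc N) M≈M′ =
    alt-cong (λ j → *-cong (M≈M′ zero j) (det-cong N (λ r c → M≈M′ (suc r) (punchIn j c))))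

  det-≗ : ∀ N {M M′ : Matrix N} → (∀ r → M r ≡ M′ r) → determinant N M ≈ determinant N M′
  det-≗ N M≗M′ = det-cong N (λ r c → reflexive (≡.cong (λ row → row c) (M≗M′ r)))

  minor-update : ∀ {N} (M : Matrix (suc N)) r v j →
    determinant N (minor (M [ suc r ]≔ v) j) ≈ determinant N (minor M j [ r ]≔ (v ∘ punchIn j))
  minor-update {N} M r v j =
    det-≗ N (map-updateAt {f = _∘′ punchIn j} (λ _ → ≡.refl) (M ∘ suc) r)

  det-linear : ∀ N (M : Matrix N) r a u v →
    determinant N (M [ r ]≔ (λ c → a * u c + v c)) ≈ a * determinant N (M [ r ]≔ u) + determinant N (M [ r ]≔ v)
  det-linear (suc N) M zero a u v =
    trans (alt-cong (λ j → lemma a (u j) (v j) _)) (alt-linear a _ _)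
    where
    lemma : ∀ a x y d → (a * x + y) * d ≈ a * (x * d) + y * d
    lemma = solve 4 (λ a x y d → (a :* x :+ y) :* d := a :* (x :* d) :+ y :* d) refl
  det-linear (suc N) M (suc r) a u v = trans (alt-cong step) (alt-linear a _ _)
    where
    lemma : ∀ m a x y → m * (a * x + y) ≈ a * (m * x) + m * y
    lemma = solve 4 (λ m a x y → m :* (a :* x :+ y) := a :* (m :* x) :+ m :* y) refl

    step : ∀ j →
      M zero j * determinant N (minor (M [ suc r ]≔ (λ c → a * u c + v c)) j) ≈
      a * (M zero j * determinant N (minor (M [ suc r ]≔ u) j)) + M zero j * determinant N (minor (M [ suc r ]≔ v) j)
    step j = begin
      M zero j * determinant N (minor (M [ suc r ]≔ (λ c → a * u c + v c)) j)
        ≈⟨ *-congˡ (trans (minor-update M r _ j) (det-linear N (minor M j) r a _ _)) ⟩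
      M zero j * (a * determinant N (minor M j [ r ]≔ (u ∘ punchIn j)) + determinant N (minor M j [ r ]≔ (v ∘ punchIn j)))
        ≈⟨ *-congˡ (+-cong (*-congˡ (minor-update M r u j)) (minor-update M r v j)) ⟨
      M zero j * (a * determinant N (minor (M [ suc r ]≔ u) j) + determinant N (minor (M [ suc r ]≔ v) j))
        ≈⟨ lemma _ a _ _ ⟩
      _ ∎

  update-cong : ∀ {N N′} (M : Fin N → Fin N′ → Carrier) r {u v : Fin N′ → Carrier} →
    (∀ c → u c ≈ v c) → ∀ s c → (M [ r ]≔ u) s c ≈ (M [ r ]≔ v) s c
  update-cong M zero    u≈v zero    c = u≈v c
  update-cong M zero    u≈v (suc s) c = refl
  update-cong M (suc r) u≈v zero    c = refl
  update-cong M (suc r) u≈v (suc s) c = update-cong (M ∘ suc) r u≈v s c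

  -- The zero row equals -1 times itself plus itself, so by linearity the determinant d satisfies d
  -- = -d + d.
  det-zero-row : ∀ N (M : Matrix N) r → determinant N (M [ r ]≔ const 0#) ≈ 0#
  det-zero-row N M r = begin
    determinant N (M [ r ]≔ const 0#)
      ≈⟨ det-cong N (update-cong M r (λ c → trans (+-identityʳ _) (zeroʳ (- 1#)))) ⟨
    determinant N (M [ r ]≔ const (- 1# * 0# + 0#))
      ≈⟨ det-linear N M r (- 1#) (const 0#) (const 0#) ⟩
    - 1# * determinant N (M [ r ]≔ const 0#) + determinant N (M [ r ]≔ const 0#)
      ≈⟨ +-congʳ (-1*x≈-x _) ⟩
    - determinant N (M [ r ]≔ const 0#) + determinant N (M [ r ]≔ const 0#)
      ≈⟨ -‿inverseˡ _ ⟩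
    0# ∎

  det-row-sum : ∀ N (M : Matrix N) r {m} (a : Fin m → Carrier) (w : Fin m → Fin N → Carrier) →
    determinant N (M [ r ]≔ (λ c → ∑[ j < m ] (a j * w j c))) ≈ ∑[ j < m ] (a j * determinant N (M [ r ]≔ w j))
  det-row-sum N M r {zero}  a w = det-zero-row N M r
  det-row-sum N M r {suc m} a w =
    trans (det-linear N M r (a zero) (w zero) _) (+-congˡ (det-row-sum N M r (a ∘ suc) (w ∘ suc)))

  -- Expanding along the rows 0 and 1 gives a double alternating sum whose summand
  -- is symmetric in the two chosen columns.
  det-alternating-01 : ∀ N (M : Matrix (suc (suc N))) → (∀ c → M zero c ≈ M (suc zero) c) →
    determinant (suc (suc N)) M ≈ 0#
  det-alternating-01 N M eq =
    trans (alt-cong (λ j → trans (sym (alt-* (M zero j) _)) (alt-cong (λ k → sym (*-assoc _ _ _)))))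
      (alt-alt-symmetric h h-sym)
    where
    h : Fin (suc (suc N)) → Fin (suc N) → Carrier
    h j k = M zero j * M (suc zero) (punchIn j k) *
      determinant N (λ r c → M (suc (suc r)) (punchIn j (punchIn k c)))

    h-sym : ∀ j k → h (punchIn j k) (pinch k j) ≈ h j k
    h-sym j k = *-cong
      (trans
        (*-cong (eq _)
          (trans (reflexive (≡.cong (M (suc zero)) (punchIn-pinch j k))) (sym (eq _))))
        (*-comm _ _))
      (det-cong N (λ r c → reflexive (≡.cong (M (suc (suc r))) (punchIn-punchIn j k c))))

  swapRows : ∀ {N} → Matrix N → Fin N → Fin N → Matrix N
  swapRows M r s = M [ r ]≔ M s [ s ]≔ M r

  -- Polarisation: for w = u + v, the determinants with rows (w , w), (u , u) and (v , v) vanish,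
  -- leaving the two mixed terms. Vanishing is assumed for this pair of rows only, because the lemma
  -- is applied while the alternating property is still being proved.
  det-swapRows : ∀ N r s → r ≢ s →
    (∀ (M : Matrix N) → (∀ c → M r c ≈ M s c) → determinant N M ≈ 0#) →
    ∀ (M : Matrix N) → determinant N M + determinant N (swapRows M r s) ≈ 0#
  det-swapRows N r s r≢s vanish M = begin
    determinant N M + q v u
      ≈⟨ +-congʳ (det-≗ N (λ t → ≡.trans
           (updateAt-id-local s (M [ r ]≔ M r)
             (≡.sym (updateAt-minimal s r M (r≢s ∘ ≡.sym))) t)
           (updateAt-id-local r M ≡.refl t))) ⟨
    q u v + q v u
      ≈⟨ solve 2 (λ x y → x :+ y := con 1 :* (con 1 :* con 0 :+ y) :+ (con 1 :* x :+ con 0)) refl _ _ ⟩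
    1# * (1# * 0# + q v u) + (1# * q u v + 0#)
      ≈⟨ +-cong (*-congˡ (+-congʳ (*-congˡ (q[x][x] u)))) (+-congˡ (q[x][x] v)) ⟨
    1# * (1# * q u u + q v u) + (1# * q u v + q v v)
      ≈⟨ +-cong (*-congˡ (linearˡ u)) (linearˡ v) ⟨
    1# * q w u + q w v
      ≈⟨ det-linear N (M [ r ]≔ w) s 1# u v ⟨
    q w w
      ≈⟨ q[x][x] w ⟩
    0# ∎
    where
    u = M r
    v = M s

    q : (Fin N → Carrier) → (Fin N → Carrier) → Carrier
    q x y = determinant N (M [ r ]≔ x [ s ]≔ y)

    q[x][x] : ∀ x → q x x ≈ 0#
    q[x][x] x = vanish _ (λ c → reflexive (≡.cong (λ row → row c)
      (≡.trans (updateAt-minimal r s _ r≢s)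
        (≡.trans (updateAt-updates r M) (≡.sym (updateAt-updates s (M [ r ]≔ x)))))))

    commute : ∀ x y → q x y ≈ determinant N (M [ s ]≔ y [ r ]≔ x)
    commute x y = det-≗ N (updateAt-commutes s r (r≢s ∘ ≡.sym) M)

    w : Fin N → Carrier
    w c = 1# * u c + v c

    linearˡ : ∀ y → q w y ≈ 1# * q u y + q v y
    linearˡ y = trans (commute w y) (trans (det-linear N (M [ s ]≔ y) r 1# u v)
      (sym (+-cong (*-congˡ (commute u y)) (commute v y))))

  -- Induction on the size. If neither row is row 0, both survive in every minor of the expansion
  -- along row 0. If one is row 0, the other is swapped into row 1, where `det-alternating-01`
  -- applies; that swap involves only rows below row 0, so the first case justifies it.
  det-alternating : ∀ N (M : Matrix N) r s → r ≢ s → (∀ c → M r c ≈ M s c) → determinant N M ≈ 0#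
  det-alternating-suc : ∀ N (M : Matrix (suc N)) r s → r ≢ s →
    (∀ c → M (suc r) c ≈ M (suc s) c) → determinant (suc N) M ≈ 0#
  det-alternating-0 : ∀ N (M : Matrix (suc N)) s →
    (∀ c → M zero c ≈ M (suc s) c) → determinant (suc N) M ≈ 0#

  det-alternating (suc N) M zero    zero    r≢s eq = contradiction ≡.refl r≢s
  det-alternating (suc N) M zero    (suc s) r≢s eq = det-alternating-0 N M s eq
  det-alternating (suc N) M (suc r) zero    r≢s eq = det-alternating-0 N M r (sym ∘ eq)
  det-alternating (suc N) M (suc r) (suc s) r≢s eq =
    det-alternating-suc N M r s (r≢s ∘ ≡.cong suc) eq

  det-alternating-suc N M r s r≢s eq = alt-zero (λ j →
    trans (*-congˡ (det-alternating N (minor M j) r s r≢s (eq ∘ punchIn j))) (zeroʳ _))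

  det-alternating-0 (suc N) M zero    eq = det-alternating-01 N M eq
  det-alternating-0 (suc N) M (suc s) eq = begin
    determinant (suc (suc N)) M
      ≈⟨ +-identityʳ _ ⟨
    determinant (suc (suc N)) M + 0#
      ≈⟨ +-congˡ (det-alternating-01 N M′ eq) ⟨
    determinant (suc (suc N)) M + determinant (suc (suc N)) M′
      ≈⟨ det-swapRows (suc (suc N)) (suc zero) (suc (suc s)) (λ ())
           (λ M → det-alternating-suc (suc N) M zero (suc s) (λ ())) M ⟩
    0# ∎
    where
    M′ = swapRows M (suc zero) (suc (suc s))

  -- Cofactors and the characteristic matrix.

  δ : ∀ {n} → Fin n → Fin n → Carrier
  δ zero    zero    = 1#
  δ zero    (suc _) = 0#
  δ (suc _) zero    = 0#
  δ (suc i) (suc j) = δ i j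

  ∑-δ : ∀ {n} (f : Fin n → Carrier) i → ∑[ j < n ] (f j * δ j i) ≈ f i
  ∑-δ {suc n} f zero = trans
    (+-cong (*-identityʳ _) (trans (sum-cong-≋ {n} (λ j → zeroʳ _)) (sum-replicate-zero n)))
    (+-identityʳ _)
  ∑-δ {suc n} f (suc i) = trans (+-cong (zeroʳ _) (∑-δ (f ∘ suc) i)) (+-identityˡ _)

  δ-refl : ∀ {n} (i : Fin n) → δ i i ≡ 1#
  δ-refl zero    = ≡.refl
  δ-refl (suc i) = δ-refl i

  δ-≢ : ∀ {n} {i j : Fin n} → i ≢ j → δ i j ≡ 0#
  δ-≢ {i = zero}  {zero}  i≢j = contradiction ≡.refl i≢j
  δ-≢ {i = zero}  {suc j} i≢j = ≡.refl
  δ-≢ {i = suc i} {zero}  i≢j = ≡.refl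
  δ-≢ {i = suc i} {suc j} i≢j = δ-≢ (i≢j ∘ ≡.cong suc)

  δ-sym : ∀ {n} (i j : Fin n) → δ i j ≡ δ j i
  δ-sym zero    zero    = ≡.refl
  δ-sym zero    (suc j) = ≡.refl
  δ-sym (suc i) zero    = ≡.refl
  δ-sym (suc i) (suc j) = δ-sym i j

  -- Replacing a row by a unit vector avoids the signs of signed minors, and makes expansion along
  -- an arbitrary row a case of linearity in that row.
  cofactor : ∀ {N} → Matrix N → Fin N → Fin N → Carrier
  cofactor {N} M r c = determinant N (M [ r ]≔ δ c)

  det-update : ∀ N (M : Matrix N) r (v : Fin N → Carrier) →
    determinant N (M [ r ]≔ v) ≈ ∑[ c < N ] (v c * cofactor M r c)
  det-update N M r v =
    trans (det-cong N (update-cong M r (λ c → sym (∑-δ v c)))) (det-row-sum N M r v δ)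

  -- This is M adj(M) = det(M) I. Off the diagonal, the sum is the determinant of a matrix
  -- containing row s twice, at positions s and r.
  cofactor-expansion : ∀ N (M : Matrix N) r s →
    ∑[ c < N ] (M s c * cofactor M r c) ≈ δ s r * determinant N M
  cofactor-expansion N M r s with s ≟ r
  ... | yes ≡.refl = begin
    ∑[ c < N ] (M r c * cofactor M r c)  ≈⟨ det-update N M r (M r) ⟨
    determinant N (M [ r ]≔ M r)                 ≈⟨ det-≗ N (updateAt-id-local r M ≡.refl) ⟩
    determinant N M                              ≈⟨ *-identityˡ _ ⟨
    1# * determinant N M                         ≡⟨ ≡.cong (_* determinant N M) (δ-refl r) ⟨
    δ r r * determinant N M                      ∎
  ... | no s≢r = begin
    ∑[ c < N ] (M s c * cofactor M r c)  ≈⟨ det-update N M r (M s) ⟨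
    determinant N (M [ r ]≔ M s)
      ≈⟨ det-alternating N _ s r s≢r (λ c → reflexive (≡.cong (λ row → row c)
           (≡.trans (updateAt-minimal s r M s≢r) (≡.sym (updateAt-updates r M))))) ⟩
    0#                                   ≈⟨ zeroˡ _ ⟨
    0# * determinant N M                         ≡⟨ ≡.cong (_* determinant N M) (δ-≢ s≢r) ⟨
    δ s r * determinant N M                      ∎

  charMatrix : ∀ {N} → Carrier → Matrix N → Matrix N
  charMatrix x A r c = x * δ r c - A r c

  private
    diagonal : ∀ x a d → x * d ≈ x * d - a + a
    diagonal x a d = sym (trans (+-assoc _ _ _) (trans (+-congˡ (-‿inverseˡ a)) (+-identityʳ _)))

    -- Write x I as M + A and expand the part from M. The result is used twice: for the recursion
    -- between cofactors and for the derivative of the determinant.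
    ∑-diagonal : ∀ N x (A : Matrix N) r s →
      ∑[ c < N ] (x * δ s c * cofactor (charMatrix x A) r c) ≈
      δ s r * determinant N (charMatrix x A) + ∑[ c < N ] (A s c * cofactor (charMatrix x A) r c)
    ∑-diagonal N x A r s = begin
      ∑[ c < N ] (x * δ s c * C c)
        ≈⟨ sum-cong-≋ {N} (λ c → trans (*-congʳ (diagonal x (A s c) (δ s c))) (distribʳ _ _ _)) ⟩
      ∑[ c < N ] (M s c * C c + A s c * C c)
        ≈⟨ ∑-distrib-+ {N} _ _ ⟩
      ∑[ c < N ] (M s c * C c) + ∑[ c < N ] (A s c * C c)
        ≈⟨ +-congʳ (cofactor-expansion N M r s) ⟩
      δ s r * determinant N M + ∑[ c < N ] (A s c * C c) ∎
      where
      M = charMatrix x A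
      C = cofactor M r

  cofactor-charMatrix : ∀ N x (A : Matrix N) r s → let M = charMatrix x A in
    x * cofactor M r s ≈ δ s r * determinant N M + ∑[ c < N ] (A s c * cofactor M r c)
  cofactor-charMatrix N x A r s = begin
    x * C s                         ≈⟨ *-congˡ (∑-δ C s) ⟨
    x * (∑[ c < N ] (C c * δ c s))  ≈⟨ *-distribˡ-sum {N} x _ ⟩
    ∑[ c < N ] (x * (C c * δ c s))
      ≈⟨ sum-cong-≋ {N} (λ c → trans (*-congˡ (trans (*-comm _ _)
           (*-congʳ (reflexive (δ-sym c s))))) (sym (*-assoc _ _ _))) ⟩
    ∑[ c < N ] (x * δ s c * C c)    ≈⟨ ∑-diagonal N x A r s ⟩
    _                               ∎
    where
    C = cofactor (charMatrix x A) r

  -- Derivations and Jacobi's formula.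

  module Derivation (D : Carrier → Carrier)
    (D-cong : ∀ {x y} → x ≈ y → D x ≈ D y)
    (D-+ : ∀ x y → D (x + y) ≈ D x + D y)
    (D-* : ∀ x y → D (x * y) ≈ D x * y + x * D y)
    where

    D-0 : D 0# ≈ 0#
    D-0 = +-cancelˡ (D 0#) _ _
      (trans (sym (D-+ 0# 0#)) (trans (D-cong (+-identityʳ 0#)) (sym (+-identityʳ _))))

    D-1 : D 1# ≈ 0#
    D-1 = +-cancelˡ (D 1#) _ _ (begin
      D 1# + D 1#            ≈⟨ +-cong (*-identityʳ _) (*-identityˡ _) ⟨
      D 1# * 1# + 1# * D 1#  ≈⟨ D-* 1# 1# ⟨
      D (1# * 1#)            ≈⟨ D-cong (*-identityʳ 1#) ⟩
      D 1#                   ≈⟨ +-identityʳ _ ⟨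
      D 1# + 0#              ∎)

    D-neg : ∀ x → D (- x) ≈ - D x
    D-neg x = +-inverseˡ-unique (D (- x)) (D x)
      (trans (sym (D-+ _ _)) (trans (D-cong (-‿inverseˡ x)) D-0))

    D-alt : ∀ {n} (f : Fin n → Carrier) → D (alt f) ≈ alt (D ∘ f)
    D-alt {zero}  f = trans (D-cong (alt-[] f)) (trans D-0 (sym (alt-[] _)))
    D-alt {suc n} f = trans (D-cong (alt-∷ f)) (trans (D-+ _ _)
      (trans (+-congˡ (trans (D-neg _) (-‿cong (D-alt (f ∘ suc))))) (sym (alt-∷ _))))

    -- Product rule along row 0: differentiating the entry gives the summand r = 0, and
    -- differentiating the minor gives the other summands by induction.
    D-det : ∀ N (M : Matrix N) → D (determinant N M) ≈ ∑[ r < N ] determinant N (M [ r ]≔ (D ∘ M r))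
    D-det zero    M = D-1
    D-det (suc N) M = begin
      D (alt (λ j → M zero j * determinant N (minor M j)))
        ≈⟨ trans (D-alt _) (alt-cong (λ j → D-* _ _)) ⟩
      alt (λ j → D (M zero j) * determinant N (minor M j) + M zero j * D (determinant N (minor M j)))
        ≈⟨ alt-+ _ _ ⟩
      alt (λ j → D (M zero j) * determinant N (minor M j)) + alt (λ j → M zero j * D (determinant N (minor M j)))
        ≈⟨ +-congˡ (trans (alt-cong step) (alt-sum N _)) ⟩
      _ ∎
      where
      step : ∀ j → M zero j * D (determinant N (minor M j)) ≈
        ∑[ r < N ] (M zero j * determinant N (minor (M [ suc r ]≔ (D ∘ M (suc r))) j))
      step j = begin
        M zero j * D (determinant N (minor M j))
          ≈⟨ *-congˡ (D-det N (minor M j)) ⟩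
        M zero j * (∑[ r < N ] determinant N (minor M j [ r ]≔ (D ∘ minor M j r)))
          ≈⟨ *-distribˡ-sum {N} _ _ ⟩
        ∑[ r < N ] (M zero j * determinant N (minor M j [ r ]≔ (D ∘ minor M j r)))
          ≈⟨ sum-cong-≋ {N} (λ r → *-congˡ (minor-update M r _ j)) ⟨
        ∑[ r < N ] (M zero j * determinant N (minor (M [ suc r ]≔ (D ∘ M (suc r))) j)) ∎

    D-δ : ∀ {n} (i j : Fin n) → D (δ i j) ≈ 0#
    D-δ zero    zero    = D-1
    D-δ zero    (suc j) = D-0
    D-δ (suc i) zero    = D-0
    D-δ (suc i) (suc j) = D-δ i j

    -- Since D fixes x and kills the entries of A, differentiating a row of x I - A leaves the
    -- corresponding row of x I, and `∑-diagonal` evaluates the resulting determinant.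
    D-det-charMatrix : ∀ N x (A : Matrix N) → D x ≈ x → (∀ r c → D (A r c) ≈ 0#) →
      let M = charMatrix x A in
      D (determinant N M) ≈ ∑[ r < N ] (determinant N M + ∑[ c < N ] (A r c * cofactor M r c))
    D-det-charMatrix N x A Dx≈x DA≈0 = trans (D-det N M) (sum-cong-≋ {N} (λ r → begin
      determinant N (M [ r ]≔ (D ∘ M r))
        ≈⟨ det-cong N (update-cong M r (D-entry r)) ⟩
      determinant N (M [ r ]≔ (λ c → x * δ r c))
        ≈⟨ det-update N M r _ ⟩
      ∑[ c < N ] (x * δ r c * cofactor M r c)
        ≈⟨ ∑-diagonal N x A r r ⟩
      δ r r * determinant N M + ∑[ c < N ] (A r c * cofactor M r c)
        ≈⟨ +-congʳ (trans (*-congʳ (reflexive (δ-refl r))) (*-identityˡ _)) ⟩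
      determinant N M + ∑[ c < N ] (A r c * cofactor M r c) ∎))
      where
      M = charMatrix x A

      D-entry : ∀ r c → D (M r c) ≈ x * δ r c
      D-entry r c = begin
        D (x * δ r c - A r c)
          ≈⟨ trans (D-+ _ _) (+-cong (D-* x _) (D-neg _)) ⟩
        D x * δ r c + x * D (δ r c) - D (A r c)
          ≈⟨ +-cong (+-cong (*-congʳ Dx≈x) (trans (*-congˡ (D-δ r c)) (zeroʳ x))) (-‿cong (DA≈0 r c)) ⟩
        x * δ r c + 0# - 0#
          ≈⟨ trans (+-assoc _ _ _) (trans (+-congˡ (-‿inverseʳ 0#)) (+-identityʳ _)) ⟩
        x * δ r c ∎

-- Power series with integer coefficients

open import Data.Integer using (ℤ; +_; 0ℤ; 1ℤ; -_; _+_; _*_; _-_; ≢-nonZero)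
open ≡ using (refl; sym; trans; cong; cong₂; _≗_)
open ≡.≡-Reasoning

Series : Set
Series = ℕ → ℤ

infixl 7 _⊛_ _⊙_
infixl 6 _⊕_

_⊕_ : Series → Series → Series
(f ⊕ g) i = f i + g i

⊖_ : Series → Series
(⊖ f) i = - f i

_⊙_ : ℤ → Series → Series
(a ⊙ f) i = a * f i

constant : ℤ → Series
constant a zero    = a
constant a (suc i) = 0ℤ

X : Series
X zero    = 0ℤ
X (suc i) = constant 1ℤ i

_⊛_ : Series → Series → Series
(f ⊛ g) zero    = f 0 * g 0
(f ⊛ g) (suc i) = f 0 * g (suc i) + ((f ∘ suc) ⊛ g) i

⊛-cong : ∀ {f f′ g g′} → f ≗ f′ → g ≗ g′ → f ⊛ g ≗ f′ ⊛ g′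
⊛-cong f≗ g≗ zero    = cong₂ _*_ (f≗ 0) (g≗ 0)
⊛-cong f≗ g≗ (suc i) = cong₂ _+_ (cong₂ _*_ (f≗ 0) (g≗ (suc i))) (⊛-cong (f≗ ∘ suc) g≗ i)

-- The recursion of `⊛` peels its left factor; commutativity requires peeling the right one as well.
⊛-sucʳ : ∀ f g i → (f ⊛ g) (suc i) ≡ (f ⊛ (g ∘ suc)) i + f (suc i) * g 0
⊛-sucʳ f g zero    = refl
⊛-sucʳ f g (suc i) = begin
  f 0 * g (2 ℕ.+ i) + ((f ∘ suc) ⊛ g) (suc i)
    ≡⟨ cong (λ y → f 0 * g (2 ℕ.+ i) + y) (⊛-sucʳ (f ∘ suc) g i) ⟩
  f 0 * g (2 ℕ.+ i) + (((f ∘ suc) ⊛ (g ∘ suc)) i + f (2 ℕ.+ i) * g 0)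
    ≡⟨ ℤ.+-assoc (f 0 * g (2 ℕ.+ i)) _ _ ⟨
  _ ∎

⊛-comm : ∀ f g → f ⊛ g ≗ g ⊛ f
⊛-comm f g zero    = ℤ.*-comm (f 0) (g 0)
⊛-comm f g (suc i) = begin
  f 0 * g (suc i) + ((f ∘ suc) ⊛ g) i  ≡⟨ cong₂ _+_ (ℤ.*-comm (f 0) _) (⊛-comm (f ∘ suc) g i) ⟩
  g (suc i) * f 0 + (g ⊛ (f ∘ suc)) i  ≡⟨ ℤ.+-comm (g (suc i) * f 0) _ ⟩
  (g ⊛ (f ∘ suc)) i + g (suc i) * f 0  ≡⟨ ⊛-sucʳ g f i ⟨
  (g ⊛ f) (suc i)                      ∎

⊛-distribʳ : ∀ h f g → (f ⊕ g) ⊛ h ≗ (f ⊛ h) ⊕ (g ⊛ h)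
⊛-distribʳ h f g zero    = ℤ.*-distribʳ-+ (h 0) (f 0) (g 0)
⊛-distribʳ h f g (suc i) = begin
  (f 0 + g 0) * h (suc i) + ((f ∘ suc ⊕ g ∘ suc) ⊛ h) i
    ≡⟨ cong (λ y → (f 0 + g 0) * h (suc i) + y) (⊛-distribʳ h (f ∘ suc) (g ∘ suc) i) ⟩
  (f 0 + g 0) * h (suc i) + (((f ∘ suc) ⊛ h) i + ((g ∘ suc) ⊛ h) i)
    ≡⟨ lemma (f 0) (g 0) (h (suc i)) _ _ ⟩
  _ ∎
  where
  lemma : ∀ a b c p q → (a + b) * c + (p + q) ≡ (a * c + p) + (b * c + q)
  lemma = solve-∀

⊛-distribˡ : ∀ h f g → h ⊛ (f ⊕ g) ≗ (h ⊛ f) ⊕ (h ⊛ g)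
⊛-distribˡ h f g i = begin
  (h ⊛ (f ⊕ g)) i        ≡⟨ ⊛-comm h (f ⊕ g) i ⟩
  ((f ⊕ g) ⊛ h) i        ≡⟨ ⊛-distribʳ h f g i ⟩
  (f ⊛ h) i + (g ⊛ h) i  ≡⟨ cong₂ _+_ (⊛-comm f h i) (⊛-comm g h i) ⟩
  (h ⊛ f) i + (h ⊛ g) i  ∎

⊙-⊛ : ∀ a f g → (a ⊙ f) ⊛ g ≗ a ⊙ (f ⊛ g)
⊙-⊛ a f g zero    = ℤ.*-assoc a (f 0) (g 0)
⊙-⊛ a f g (suc i) = begin
  a * f 0 * g (suc i) + ((a ⊙ (f ∘ suc)) ⊛ g) i
    ≡⟨ cong₂ _+_ (ℤ.*-assoc a (f 0) (g (suc i))) (⊙-⊛ a (f ∘ suc) g i) ⟩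
  a * (f 0 * g (suc i)) + a * ((f ∘ suc) ⊛ g) i
    ≡⟨ ℤ.*-distribˡ-+ a (f 0 * g (suc i)) _ ⟨
  _ ∎

⊛-assoc : ∀ f g h → (f ⊛ g) ⊛ h ≗ f ⊛ (g ⊛ h)
⊛-assoc f g h zero    = ℤ.*-assoc (f 0) (g 0) (h 0)
⊛-assoc f g h (suc i) = begin
  f 0 * g 0 * h (suc i) + (((f 0 ⊙ (g ∘ suc)) ⊕ ((f ∘ suc) ⊛ g)) ⊛ h) i
    ≡⟨ cong (λ y → f 0 * g 0 * h (suc i) + y) (trans (⊛-distribʳ h _ _ i)
         (cong₂ _+_ (⊙-⊛ (f 0) (g ∘ suc) h i) (⊛-assoc (f ∘ suc) g h i))) ⟩
  f 0 * g 0 * h (suc i) + (f 0 * ((g ∘ suc) ⊛ h) i + ((f ∘ suc) ⊛ (g ⊛ h)) i)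
    ≡⟨ lemma (f 0) (g 0) (h (suc i)) (((g ∘ suc) ⊛ h) i) _ ⟩
  _ ∎
  where
  lemma : ∀ a b c p q → a * b * c + (a * p + q) ≡ a * (b * c + p) + q
  lemma = solve-∀

0-⊛ : ∀ f → (λ _ → 0ℤ) ⊛ f ≗ (λ _ → 0ℤ)
0-⊛ f zero    = refl
0-⊛ f (suc i) = trans (ℤ.+-identityˡ _) (0-⊛ f i)

constant-⊛ : ∀ a f → constant a ⊛ f ≗ a ⊙ f
constant-⊛ a f zero    = refl
constant-⊛ a f (suc i) = trans (cong (λ y → a * f (suc i) + y) (0-⊛ f i)) (ℤ.+-identityʳ _)

1-⊛ : ∀ f → constant 1ℤ ⊛ f ≗ f
1-⊛ f i = trans (constant-⊛ 1ℤ f i) (ℤ.*-identityˡ _)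

X-⊛ : ∀ f i → (X ⊛ f) (suc i) ≡ f i
X-⊛ f i = trans (ℤ.+-identityˡ _) (1-⊛ f i)

seriesRing : CommutativeRing 0ℓ 0ℓ
seriesRing = record
  { Carrier = Series
  ; _≈_ = _≗_
  ; _+_ = _⊕_
  ; _*_ = _⊛_
  ; -_ = ⊖_
  ; 0# = λ _ → 0ℤ
  ; 1# = constant 1ℤ
  ; isCommutativeRing = record
    { isRing = record
      { +-isAbelianGroup = record
        { isGroup = record
          { isMonoid = record
            { isSemigroup = record
              { isMagma = record
                { isEquivalence = record
                  { refl = λ _ → refl
                  ; sym = λ f≗g i → sym (f≗g i)
                  ; trans = λ f≗g g≗h i → trans (f≗g i) (g≗h i)
                  }
                ; ∙-cong = λ f≗ g≗ i → cong₂ _+_ (f≗ i) (g≗ i)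
                }
              ; assoc = λ f g h i → ℤ.+-assoc (f i) (g i) (h i)
              }
            ; identity = (λ f i → ℤ.+-identityˡ (f i)) , (λ f i → ℤ.+-identityʳ (f i))
            }
          ; inverse = (λ f i → ℤ.+-inverseˡ (f i)) , (λ f i → ℤ.+-inverseʳ (f i))
          ; ⁻¹-cong = λ f≗g i → cong -_ (f≗g i)
          }
        ; comm = λ f g i → ℤ.+-comm (f i) (g i)
        }
      ; *-cong = ⊛-cong
      ; *-assoc = ⊛-assoc
      ; *-identity = 1-⊛ , (λ f i → trans (⊛-comm f _ i) (1-⊛ f i))
      ; distrib = ⊛-distribˡ , ⊛-distribʳ
      }
    ; *-comm = ⊛-comm
    }
  }

-- The derivation x d/dx, which unlike d/dx shifts no coefficients.
θ : Series → Series
θ f i = + i * f i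

θ-⊕ : ∀ f g → θ (f ⊕ g) ≗ θ f ⊕ θ g
θ-⊕ f g i = ℤ.*-distribˡ-+ (+ i) (f i) (g i)

θ-⊛ : ∀ f g → θ (f ⊛ g) ≗ (θ f ⊛ g) ⊕ (f ⊛ θ g)
θ-⊛ f g zero    = sym (trans (ℤ.+-identityˡ _) (ℤ.*-zeroʳ (f 0)))
θ-⊛ f g (suc i) = begin
  + suc i * (f 0 * g (suc i) + (f′ ⊛ g) i)
    ≡⟨ lemma (+ i) (f 0) (g (suc i)) ((f′ ⊛ g) i) ⟩
  f 0 * (+ suc i * g (suc i)) + (+ i * (f′ ⊛ g) i + (f′ ⊛ g) i)
    ≡⟨ cong (λ y → c + (y + (f′ ⊛ g) i)) (θ-⊛ f′ g i) ⟩
  f 0 * (+ suc i * g (suc i)) + ((θ f′ ⊛ g) i + (f′ ⊛ θ g) i + (f′ ⊛ g) i)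
    ≡⟨ lemma₂ c ((θ f′ ⊛ g) i) ((f′ ⊛ θ g) i) ((f′ ⊛ g) i) ⟩
  -- The leading `0ℤ` is what `θ f 0 * g (suc i)` reduces to, as θ kills the constant coefficient.
  0ℤ + ((θ f′ ⊛ g) i + (f′ ⊛ g) i) + (f 0 * (+ suc i * g (suc i)) + (f′ ⊛ θ g) i)
    ≡⟨ cong (λ y → 0ℤ + y + (c + (f′ ⊛ θ g) i)) (trans (sym (⊛-distribʳ g (θ f′) f′ i))
         (⊛-cong (λ j → lemma₃ (+ j) (f′ j)) (λ _ → refl) i)) ⟩
  0ℤ + ((θ f ∘ suc) ⊛ g) i + (f 0 * (+ suc i * g (suc i)) + (f′ ⊛ θ g) i) ∎
  where
  f′ = f ∘ suc
  c = f 0 * (+ suc i * g (suc i))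

  lemma : ∀ i a b c → (1ℤ + i) * (a * b + c) ≡ a * ((1ℤ + i) * b) + (i * c + c)
  lemma = solve-∀

  lemma₂ : ∀ a b c d → a + (b + c + d) ≡ 0ℤ + (b + d) + (a + c)
  lemma₂ = solve-∀

  lemma₃ : ∀ j a → j * a + a ≡ (1ℤ + j) * a
  lemma₃ = solve-∀

θ-X : θ X ≗ X
θ-X zero          = refl
θ-X (suc zero)    = refl
θ-X (suc (suc i)) = ℤ.*-zeroʳ (+ suc (suc i))

θ-constant : ∀ a → θ (constant a) ≗ (λ _ → 0ℤ)
θ-constant a zero    = refl
θ-constant a (suc i) = ℤ.*-zeroʳ (+ suc i)

-- Newton's identities

module ℤDet = Determinant ℤ.+-*-commutativeRing
module SDet = Determinant seriesRing
module SSum = Sum (CommutativeRing.semiring seriesRing)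
open Sum (CommutativeRing.semiring ℤ.+-*-commutativeRing)
open ℤDet using (Matrix; δ; δ-refl; δ-≢; δ-sym; ∑-δ)

infixl 7 _·_

_·_ : ∀ {l m n} → (Fin l → Fin m → ℤ) → (Fin m → Fin n → ℤ) → Fin l → Fin n → ℤ
_·_ {m = m} B A r c = ∑[ s < m ] (B r s * A s c)

tr : ∀ {n} → Matrix n → ℤ
tr {n} A = ∑[ r < n ] A r r

-- The exponent is shifted: `pow A k` is the power k + 1. Newton's recursion starts from A itself,
-- the trace of the identity being the factor `+ N` in `newton`.
pow : ∀ {n} → Matrix n → ℕ → Matrix n
pow A zero    = A
pow A (suc k) = pow A k · A

∑-const : ∀ n x → ∑[ i < n ] x ≡ + n * x
∑-const zero    x = refl
∑-const (suc n) x = trans (cong (λ y → x + y) (∑-const n x)) (sym (ℤ.suc-* (+ n) x))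

sum-coeff : ∀ {n} (f : Fin n → Series) i → SSum.sum f i ≡ ∑[ j < n ] f j i
sum-coeff {zero}  f i = refl
sum-coeff {suc n} f i = cong (λ y → f zero i + y) (sum-coeff (f ∘ suc) i)

alt-coeff : ∀ {n} (f : Fin n → Series) i → SDet.alt f i ≡ ℤDet.alt (λ j → f j i)
alt-coeff {zero}  f i = trans (SDet.alt-[] f i) (sym (ℤDet.alt-[] _))
alt-coeff {suc n} f i = begin
  SDet.alt f i                                 ≡⟨ SDet.alt-∷ f i ⟩
  f zero i - SDet.alt (f ∘ suc) i              ≡⟨ cong (λ y → f zero i - y) (alt-coeff (f ∘ suc) i) ⟩
  f zero i - ℤDet.alt (λ j → f (suc j) i)      ≡⟨ ℤDet.alt-∷ _ ⟨
  ℤDet.alt (λ j → f j i)                       ∎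

δ-coeff : ∀ {n} (r s : Fin n) f i → (SDet.δ r s ⊛ f) i ≡ δ r s * f i
δ-coeff zero    zero    f i = constant-⊛ 1ℤ f i
δ-coeff zero    (suc s) f i = 0-⊛ f i
δ-coeff (suc r) zero    f i = 0-⊛ f i
δ-coeff (suc r) (suc s) f i = δ-coeff r s f i

constant-sum-coeff : ∀ {n} (a : Fin n → ℤ) (f : Fin n → Series) i →
  SSum.sum (λ j → constant (a j) ⊛ f j) i ≡ ∑[ j < n ] (a j * f j i)
constant-sum-coeff {n} a f i =
  trans (sum-coeff {n} (λ j → constant (a j) ⊛ f j) i) (sum-cong-≗ {n} (λ j → constant-⊛ (a j) (f j) i))

-- Degree and leading coefficient of determinants with linear entries.

LinearEntries : ∀ {n m} → (Fin n → Fin m → Series) → Set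
LinearEntries M = ∀ r c i → M r c (suc (suc i)) ≡ 0ℤ

linear-⊛ : ∀ f g → (∀ i → f (suc (suc i)) ≡ 0ℤ) →
  ∀ i → (f ⊛ g) (suc i) ≡ f 0 * g (suc i) + f 1 * g i
linear-⊛ f g f≥2≡0 i = cong (λ y → f 0 * g (suc i) + y)
  (trans (⊛-cong (λ { zero → refl ; (suc j) → f≥2≡0 j }) (λ _ → refl) i) (constant-⊛ (f 1) g i))

det-degree : ∀ N (M : SDet.Matrix N) → LinearEntries M → ∀ i → N ℕ.< i → SDet.determinant N M i ≡ 0ℤ
det-degree zero    M lin (suc i) _         = refl
det-degree (suc N) M lin (suc i) (s≤s N<i) =
  trans (alt-coeff {suc N} (λ j → M zero j ⊛ SDet.determinant N (SDet.minor M j)) (suc i)) (ℤDet.alt-zero (λ j → begin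
    (M zero j ⊛ SDet.determinant N (SDet.minor M j)) (suc i)
      ≡⟨ linear-⊛ (M zero j) _ (lin zero j) i ⟩
    M zero j 0 * SDet.determinant N (SDet.minor M j) (suc i) + M zero j 1 * SDet.determinant N (SDet.minor M j) i
      ≡⟨ cong₂ (λ y z → M zero j 0 * y + M zero j 1 * z)
           (ih j (suc i) (ℕ.m<n⇒m<1+n N<i)) (ih j i N<i) ⟩
    M zero j 0 * 0ℤ + M zero j 1 * 0ℤ
      ≡⟨ cong₂ _+_ (ℤ.*-zeroʳ (M zero j 0)) (ℤ.*-zeroʳ (M zero j 1)) ⟩
    0ℤ ∎))
  where
  ih : ∀ j i → N ℕ.< i → SDet.determinant N (SDet.minor M j) i ≡ 0ℤ
  ih j = det-degree N (SDet.minor M j) (λ r c → lin (suc r) (punchIn j c))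

-- By the degree bound on minors, coefficient N draws only the linear coefficient from each entry.
-- Comparing two matrices spares evaluating the leading coefficient.
det-leading : ∀ N (M M′ : SDet.Matrix N) → LinearEntries M → LinearEntries M′ →
  (∀ r c → M r c 1 ≡ M′ r c 1) → SDet.determinant N M N ≡ SDet.determinant N M′ N
det-leading zero    M M′ lin lin′ eq = refl
det-leading (suc N) M M′ lin lin′ eq = begin
  SDet.determinant (suc N) M (suc N)
    ≡⟨ alt-coeff _ (suc N) ⟩
  ℤDet.alt (λ j → (M zero j ⊛ SDet.determinant N (SDet.minor M j)) (suc N))
    ≡⟨ ℤDet.alt-cong (λ j → trans (top M lin j) (trans (step j) (sym (top M′ lin′ j)))) ⟩
  ℤDet.alt (λ j → (M′ zero j ⊛ SDet.determinant N (SDet.minor M′ j)) (suc N))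
    ≡⟨ alt-coeff _ (suc N) ⟨
  SDet.determinant (suc N) M′ (suc N) ∎
  where
  top : ∀ M → LinearEntries M → ∀ j →
    (M zero j ⊛ SDet.determinant N (SDet.minor M j)) (suc N) ≡ M zero j 1 * SDet.determinant N (SDet.minor M j) N
  top M lin j = begin
    (M zero j ⊛ d) (suc N)                   ≡⟨ linear-⊛ (M zero j) d (lin zero j) N ⟩
    M zero j 0 * d (suc N) + M zero j 1 * d N
      ≡⟨ cong (λ y → M zero j 0 * y + M zero j 1 * d N)
           (det-degree N _ (λ r c → lin (suc r) (punchIn j c)) (suc N) (ℕ.n<1+n N)) ⟩
    M zero j 0 * 0ℤ + M zero j 1 * d N       ≡⟨ cong (_+ M zero j 1 * d N) (ℤ.*-zeroʳ (M zero j 0)) ⟩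
    0ℤ + M zero j 1 * d N                    ≡⟨ ℤ.+-identityˡ _ ⟩
    M zero j 1 * d N                         ∎
    where d = SDet.determinant N (SDet.minor M j)

  step : ∀ j → M zero j 1 * SDet.determinant N (SDet.minor M j) N ≡ M′ zero j 1 * SDet.determinant N (SDet.minor M′ j) N
  step j = cong₂ _*_ (eq zero j)
    (det-leading N _ _ (λ r c → lin (suc r) (punchIn j c)) (λ r c → lin′ (suc r) (punchIn j c))
      (λ r c → eq (suc r) (punchIn j c)))

update-linear : ∀ {n m} (M : Fin n → Fin m → Series) r v → LinearEntries M →
  (∀ c i → v c (suc (suc i)) ≡ 0ℤ) → LinearEntries (M [ r ]≔ v)
update-linear M zero    v lin linᵥ zero    = linᵥ
update-linear M zero    v lin linᵥ (suc s) = lin (suc s)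
update-linear M (suc r) v lin linᵥ zero    = lin zero
update-linear M (suc r) v lin linᵥ (suc s) = update-linear (M ∘ suc) r v (lin ∘ suc) linᵥ s

δ-linear : ∀ {n} (r c : Fin n) i → SDet.δ r c (suc i) ≡ 0ℤ
δ-linear zero    zero    i = refl
δ-linear zero    (suc c) i = refl
δ-linear (suc r) zero    i = refl
δ-linear (suc r) (suc c) i = δ-linear r c i

-- The characteristic polynomial and its cofactors.

module Characteristic {N : ℕ} (A : Matrix N) where

  xI-A : SDet.Matrix N
  xI-A = SDet.charMatrix X (λ r c → constant (A r c))

  p : Series
  p = SDet.determinant N xI-A

  C : Fin N → Fin N → Series
  C = SDet.cofactor xI-A

  xI-A-linear : LinearEntries xI-A
  xI-A-linear r c i =
    trans (ℤ.+-identityʳ _) (trans (X-⊛ (SDet.δ r c) (suc i)) (δ-linear r c i))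

  p-degree : ∀ i → N ℕ.< i → p i ≡ 0ℤ
  p-degree = det-degree N xI-A xI-A-linear

  -- The bound N, though not sharp, comes directly from the row-replaced matrix and suffices for a
  -- descent from index N + 1.
  C-degree : ∀ r s i → N ℕ.< i → C r s i ≡ 0ℤ
  C-degree r s = det-degree N _ (update-linear xI-A r _ xI-A-linear (λ c i → δ-linear s c (suc i)))

  C-step : ∀ r s i → C r s i ≡ δ s r * p (suc i) + ∑[ c < N ] (A s c * C r c (suc i))
  C-step r s i = begin
    C r s i                ≡⟨ X-⊛ (C r s) i ⟨
    (X ⊛ C r s) (suc i)    ≡⟨ SDet.cofactor-charMatrix N X (λ r c → constant (A r c)) r s (suc i) ⟩
    (SDet.δ s r ⊛ p) (suc i) + SSum.sum (λ c → constant (A s c) ⊛ C r c) (suc i)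
      ≡⟨ cong₂ _+_ (δ-coeff s r p (suc i)) (constant-sum-coeff (A s) (C r) (suc i)) ⟩
    δ s r * p (suc i) + ∑[ c < N ] (A s c * C r c (suc i)) ∎

  -- Coefficient i of the trace of B adj(x I - A), the adjugate being the transpose of `C`.
  pairing : Matrix N → ℕ → ℤ
  pairing B i = ∑[ r < N ] ∑[ s < N ] (B r s * C r s i)

  newton : ∀ i → + i * p i ≡ + N * p i + pairing A i
  newton i = begin
    θ p i
      ≡⟨ SDet.Derivation.D-det-charMatrix θ (λ f≗g i → cong (λ y → + i * y) (f≗g i)) θ-⊕ θ-⊛ N X _
           θ-X (λ r c → θ-constant (A r c)) i ⟩
    SSum.sum (λ r → p ⊕ SSum.sum (λ c → constant (A r c) ⊛ C r c)) i
      ≡⟨ sum-coeff {N} (λ r → p ⊕ SSum.sum (λ c → constant (A r c) ⊛ C r c)) i ⟩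
    ∑[ r < N ] (p i + SSum.sum (λ c → constant (A r c) ⊛ C r c) i)
      ≡⟨ sum-cong-≗ {N} (λ r → cong (λ y → p i + y) (constant-sum-coeff (A r) (C r) i)) ⟩
    ∑[ r < N ] (p i + ∑[ c < N ] (A r c * C r c i))
      ≡⟨ ∑-distrib-+ {N} (λ _ → p i) _ ⟩
    ∑[ r < N ] p i + pairing A i
      ≡⟨ cong (_+ pairing A i) (∑-const N (p i)) ⟩
    + N * p i + pairing A i ∎

  -- Take the trace of B times x adj = p I + A adj. Iterated from B = A, this expresses
  -- `pairing A i` through the power traces and the coefficients of p above i, as in Newton's
  -- identities.
  pairing-step : ∀ B i → pairing B i ≡ tr B * p (suc i) + pairing (B · A) (suc i)
  pairing-step B i = begin
    pairing B i
      ≡⟨ sum-cong-≗ {N} row ⟩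
    ∑[ r < N ] (B r r * q + ∑[ c < N ] ((B · A) r c * C r c (suc i)))
      ≡⟨ ∑-distrib-+ {N} (λ r → B r r * q) _ ⟩
    ∑[ r < N ] (B r r * q) + pairing (B · A) (suc i)
      ≡⟨ cong (_+ pairing (B · A) (suc i)) (*-distribʳ-sum {N} q (λ r → B r r)) ⟨
    tr B * q + pairing (B · A) (suc i) ∎
    where
    q = p (suc i)

    row : ∀ r → ∑[ s < N ] (B r s * C r s i) ≡ B r r * q + ∑[ c < N ] ((B · A) r c * C r c (suc i))
    row r = begin
      ∑[ s < N ] (B r s * C r s i)
        ≡⟨ sum-cong-≗ {N} (λ s → begin
             B r s * C r s i
               ≡⟨ cong (λ y → B r s * y) (C-step r s i) ⟩
             B r s * (δ s r * q + ∑[ c < N ] (A s c * D c))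
               ≡⟨ ℤ.*-distribˡ-+ (B r s) (δ s r * q) _ ⟩
             B r s * (δ s r * q) + B r s * (∑[ c < N ] (A s c * D c))
               ≡⟨ cong₂ _+_ (sym (ℤ.*-assoc (B r s) (δ s r) q)) (*-distribˡ-sum {N} (B r s) _) ⟩
             B r s * δ s r * q + ∑[ c < N ] (B r s * (A s c * D c))
               ≡⟨ cong (λ y → B r s * δ s r * q + y)
                    (sum-cong-≗ {N} (λ c → ℤ.*-assoc (B r s) (A s c) (D c))) ⟨
             B r s * δ s r * q + ∑[ c < N ] (B r s * A s c * D c) ∎) ⟩
      ∑[ s < N ] (B r s * δ s r * q + ∑[ c < N ] (B r s * A s c * D c))
        ≡⟨ ∑-distrib-+ {N} (λ s → B r s * δ s r * q) _ ⟩
      ∑[ s < N ] (B r s * δ s r * q) + ∑[ s < N ] ∑[ c < N ] (B r s * A s c * D c)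
        ≡⟨ cong₂ _+_
             (trans (sym (*-distribʳ-sum {N} q (λ s → B r s * δ s r))) (cong (_* q) (∑-δ (B r) r)))
             (trans (∑-comm {N} {N} (λ s c → B r s * A s c * D c))
               (sum-cong-≗ {N} (λ c → sym (*-distribʳ-sum {N} (D c) (λ s → B r s * A s c))))) ⟩
      B r r * q + ∑[ c < N ] ((B · A) r c * D c) ∎
      where
      D : Fin N → ℤ
      D c = C r c (suc i)

-- Determination of the coefficients by the power traces.

module _ {N : ℕ} (A A′ : Matrix N) (tr-pow : ∀ k → tr (pow A k) ≡ tr (pow A′ k)) where

  private
    module Ch  = Characteristic A
    module Ch′ = Characteristic A′

  leading : Ch.p N ≡ Ch′.p N
  leading = det-leading N Ch.xI-A Ch′.xI-A Ch.xI-A-linear Ch′.xI-A-linear (λ _ _ → refl)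

  -- Newton's identities, solved from the top coefficient downwards.
  agree : ∀ d i → i ℕ.+ d ≡ suc N →
    (∀ k → Ch.pairing (pow A k) i ≡ Ch′.pairing (pow A′ k) i) × Ch.p i ≡ Ch′.p i
  agree zero i i≡1+N =
    (λ k → trans (vanish A k) (sym (vanish A′ k))) ,
    trans (Ch.p-degree i N<i) (sym (Ch′.p-degree i N<i))
    where
    N<i : N ℕ.< i
    N<i = ℕ.≤-reflexive (sym (trans (sym (ℕ.+-identityʳ i)) i≡1+N))

    vanish : ∀ A k → Characteristic.pairing A (pow A k) i ≡ 0ℤ
    vanish A k = trans (sum-cong-≗ {N} (λ r → trans
        (sum-cong-≗ {N} (λ s → trans (cong (λ y → pow A k r s * y) (Characteristic.C-degree A r s i N<i))
          (ℤ.*-zeroʳ (pow A k r s))))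
        (sum-replicate-zero N)))
      (sum-replicate-zero N)
  agree (suc d) i i+1+d≡1+N = pairings , coefficient
    where
    ih : (∀ k → Ch.pairing (pow A k) (suc i) ≡ Ch′.pairing (pow A′ k) (suc i)) ×
         Ch.p (suc i) ≡ Ch′.p (suc i)
    ih = agree d (suc i) (trans (sym (ℕ.+-suc i d)) i+1+d≡1+N)

    -- Exponent k at index i calls for exponent k + 1 at index i + 1, so the induction carries all
    -- exponents at once.
    pairings : ∀ k → Ch.pairing (pow A k) i ≡ Ch′.pairing (pow A′ k) i
    pairings k = begin
      Ch.pairing (pow A k) i
        ≡⟨ Ch.pairing-step (pow A k) i ⟩
      tr (pow A k) * Ch.p (suc i) + Ch.pairing (pow A (suc k)) (suc i)
        ≡⟨ cong₂ _+_ (cong₂ _*_ (tr-pow k) (proj₂ ih)) (proj₁ ih (suc k)) ⟩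
      tr (pow A′ k) * Ch′.p (suc i) + Ch′.pairing (pow A′ (suc k)) (suc i)
        ≡⟨ Ch′.pairing-step (pow A′ k) i ⟨
      Ch′.pairing (pow A′ k) i ∎

    coefficient : Ch.p i ≡ Ch′.p i
    coefficient with i ℕ.≟ N
    -- Here i - N is zero and Newton's identity says nothing about the coefficient; in the other
    -- case the factor is cancelled in ℤ.
    ... | yes refl = leading
    ... | no  i≢N  = ℤ.*-cancelˡ-≡ (+ i - + N) (Ch.p i) (Ch′.p i) {{≢-nonZero i-N≢0}} (begin
      (+ i - + N) * Ch.p i       ≡⟨ difference A ⟩
      Ch.pairing A i             ≡⟨ pairings 0 ⟩
      Ch′.pairing A′ i           ≡⟨ difference A′ ⟨
      (+ i - + N) * Ch′.p i      ∎)
      where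
      i-N≢0 : + i - + N ≢ 0ℤ
      i-N≢0 eq = i≢N (ℤ.+-injective (ℤ.i-j≡0⇒i≡j (+ i) (+ N) eq))

      lemma : ∀ i n p → (i - n) * p ≡ i * p - n * p
      lemma = solve-∀

      lemma₂ : ∀ a b → a + b - a ≡ b
      lemma₂ = solve-∀

      difference : ∀ A → (+ i - + N) * Characteristic.p A i ≡ Characteristic.pairing A A i
      difference A = begin
        (+ i - + N) * a          ≡⟨ lemma (+ i) (+ N) a ⟩
        + i * a - + N * a        ≡⟨ cong (λ y → y - + N * a) (Characteristic.newton A i) ⟩
        + N * a + b - + N * a    ≡⟨ lemma₂ (+ N * a) b ⟩
        b                        ∎
        where
        a = Characteristic.p A i
        b = Characteristic.pairing A A i

  characteristic-unique : Ch.p ≗ Ch′.p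
  characteristic-unique i with i ℕ.≤? N
  ... | yes i≤N = proj₂ (agree (suc N ℕ.∸ i) i (ℕ.m+[n∸m]≡n (ℕ.m≤n⇒m≤1+n i≤N)))
  ... | no  i≰N = trans (Ch.p-degree i (ℕ.≰⇒> i≰N)) (sym (Ch′.p-degree i (ℕ.≰⇒> i≰N)))

-- Commuting blocks

·-assoc : ∀ {k l m n} (B : Fin k → Fin l → ℤ) (C : Fin l → Fin m → ℤ) (D : Fin m → Fin n → ℤ) r c →
  ((B · C) · D) r c ≡ (B · (C · D)) r c
·-assoc {l = l} {m} B C D r c = begin
  ∑[ t < m ] (∑[ s < l ] (B r s * C s t) * D t c)
    ≡⟨ sum-cong-≗ {m} (λ t → *-distribʳ-sum {l} (D t c) (λ s → B r s * C s t)) ⟩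
  ∑[ t < m ] ∑[ s < l ] (B r s * C s t * D t c)
    ≡⟨ ∑-comm {m} {l} (λ t s → B r s * C s t * D t c) ⟩
  ∑[ s < l ] ∑[ t < m ] (B r s * C s t * D t c)
    ≡⟨ sum-cong-≗ {l} (λ s → trans
         (sum-cong-≗ {m} (λ t → ℤ.*-assoc (B r s) (C s t) (D t c)))
         (sym (*-distribˡ-sum {m} (B r s) (λ t → C s t * D t c)))) ⟩
  ∑[ s < l ] (B r s * (C · D) s c) ∎

·-congˡ : ∀ {l m n} (B : Fin l → Fin m → ℤ) {C C′ : Fin m → Fin n → ℤ} →
  (∀ r c → C r c ≡ C′ r c) → ∀ r c → (B · C) r c ≡ (B · C′) r c
·-congˡ {m = m} B C≗C′ r c = sum-cong-≗ {m} (λ s → cong (λ y → B r s * y) (C≗C′ s c))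

·-congʳ : ∀ {l m n} {B B′ : Fin l → Fin m → ℤ} (C : Fin m → Fin n → ℤ) →
  (∀ r c → B r c ≡ B′ r c) → ∀ r c → (B · C) r c ≡ (B′ · C) r c
·-congʳ {m = m} C B≗B′ r c = sum-cong-≗ {m} (λ s → cong (λ y → y * C s c) (B≗B′ r s))

pow-comm : ∀ {n} (A : Matrix n) k r c → (A · pow A k) r c ≡ (pow A k · A) r c
pow-comm A zero    r c = refl
pow-comm A (suc k) r c = trans (sym (·-assoc A (pow A k) A r c)) (·-congʳ A (pow-comm A k) r c)

Commute : ∀ {m} → Matrix m → Matrix m → Set
Commute B C = ∀ r c → (B · C) r c ≡ (C · B) r c

Commute-resp : ∀ {m} {B B′ C C′ : Matrix m} → (∀ r c → B r c ≡ B′ r c) → (∀ r c → C r c ≡ C′ r c) →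
  Commute B′ C′ → Commute B C
Commute-resp {B = B} {B′} {C} {C′} B≗ C≗ comm r c = begin
  (B · C) r c    ≡⟨ trans (·-congʳ C B≗ r c) (·-congˡ B′ C≗ r c) ⟩
  (B′ · C′) r c  ≡⟨ comm r c ⟩
  (C′ · B′) r c  ≡⟨ trans (·-congʳ B C≗ r c) (·-congˡ C′ B≗ r c) ⟨
  (C · B) r c    ∎

Commute-· : ∀ {m} {B C D : Matrix m} → Commute B D → Commute C D → Commute (B · C) D
Commute-· {B = B} {C} {D} BD CD r c = begin
  ((B · C) · D) r c  ≡⟨ ·-assoc B C D r c ⟩
  (B · (C · D)) r c  ≡⟨ ·-congˡ B CD r c ⟩
  (B · (D · C)) r c  ≡⟨ ·-assoc B D C r c ⟨
  ((B · D) · C) r c  ≡⟨ ·-congʳ C BD r c ⟩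
  ((D · B) · C) r c  ≡⟨ ·-assoc D B C r c ⟩
  (D · (B · C)) r c  ∎

Commute-∑ : ∀ {m k} (B : Fin k → Matrix m) {D : Matrix m} → (∀ s → Commute (B s) D) →
  Commute (λ r c → ∑[ s < k ] B s r c) D
Commute-∑ {m} {k} B {D} BD r c = begin
  ∑[ t < m ] (∑[ s < k ] B s r t * D t c)
    ≡⟨ sum-cong-≗ {m} (λ t → *-distribʳ-sum {k} (D t c) (λ s → B s r t)) ⟩
  ∑[ t < m ] ∑[ s < k ] (B s r t * D t c)
    ≡⟨ ∑-comm {m} {k} (λ t s → B s r t * D t c) ⟩
  ∑[ s < k ] (B s · D) r c
    ≡⟨ sum-cong-≗ {k} (λ s → BD s r c) ⟩
  ∑[ s < k ] (D · B s) r c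
    ≡⟨ ∑-comm {k} {m} (λ s t → D r t * B s t c) ⟩
  ∑[ t < m ] ∑[ s < k ] (D r t * B s t c)
    ≡⟨ sum-cong-≗ {m} (λ t → *-distribˡ-sum {k} (D r t) (λ s → B s t c)) ⟨
  ∑[ t < m ] (D r t * (∑[ s < k ] B s t c)) ∎

Commute-I : ∀ {m} (B : Matrix m) → Commute δ B
Commute-I {m} B r c = begin
  ∑[ s < m ] (δ r s * B s c)
    ≡⟨ sum-cong-≗ {m} (λ s → trans (ℤ.*-comm (δ r s) (B s c)) (cong (λ y → B s c * y) (δ-sym r s))) ⟩
  ∑[ s < m ] (B s c * δ s r)  ≡⟨ ∑-δ (λ s → B s c) r ⟩
  B r c                       ≡⟨ ∑-δ (B r) c ⟨
  ∑[ s < m ] (B r s * δ s c)  ∎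

Commute-0 : ∀ {m} (B : Matrix m) → Commute (λ _ _ → 0ℤ) B
Commute-0 {m} B r c = sum-cong-≗ {m} (λ s → sym (ℤ.*-zeroʳ (B r s)))

∑-++ : ∀ m {n} (f : Fin (m ℕ.+ n) → ℤ) →
  ∑[ x < m ℕ.+ n ] f x ≡ ∑[ i < m ] f (i ↑ˡ n) + ∑[ j < n ] f (m ↑ʳ j)
∑-++ zero        f = sym (ℤ.+-identityˡ _)
∑-++ (suc m) {n} f = trans (cong (λ y → f zero + y) (∑-++ m (f ∘ suc)))
  (sym (ℤ.+-assoc (f zero) (∑[ i < m ] f (suc i ↑ˡ n)) _))

∑-combine : ∀ k {m} (f : Fin (k ℕ.* m) → ℤ) →
  ∑[ x < k ℕ.* m ] f x ≡ ∑[ p < k ] ∑[ α < m ] f (combine p α)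
∑-combine zero        f = refl
∑-combine (suc k) {m} f =
  trans (∑-++ m f) (cong (λ y → ∑[ α < m ] f (α ↑ˡ (k ℕ.* m)) + y) (∑-combine k (f ∘ (m ↑ʳ_))))

-- Powers of matrices with commuting blocks.

module Blocks (k m : ℕ) where

  block : Matrix (k ℕ.* m) → Fin k → Fin k → Matrix m
  block B p q α β = B (combine p α) (combine q β)

  block-· : ∀ (B C : Matrix (k ℕ.* m)) p q α β →
    block (B · C) p q α β ≡ ∑[ s < k ] (block B p s · block C s q) α β
  block-· B C p q α β = ∑-combine k {m} (λ x → B (combine p α) x * C x (combine q β))

  -- Blocks of a power are sums of products of blocks of A, and the matrices commuting with D are
  -- closed under both operations.
  Commute-block-pow : ∀ (A : Matrix (k ℕ.* m)) {D : Matrix m} →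
    (∀ p q → Commute (block A p q) D) → ∀ e p q → Commute (block (pow A e) p q) D
  Commute-block-pow A AD zero    p q = AD p q
  Commute-block-pow A AD (suc e) p q =
    Commute-resp (block-· (pow A e) A p q) (λ _ _ → refl)
      (Commute-∑ (λ s → block (pow A e) p s · block A s q)
        (λ s → Commute-· (Commute-block-pow A AD e p s) (AD s q)))

  module _ (A A′ : Matrix (k ℕ.* m))
    (transposed : ∀ p q α β → block A′ p q α β ≡ block A q p α β)
    (commuting : ∀ p q s t → Commute (block A p q) (block A s t))
    where

    block-pow-transposed : ∀ e p q α β → block (pow A′ e) p q α β ≡ block (pow A e) q p α β
    block-pow-transposed zero    p q α β = transposed p q α β
    block-pow-transposed (suc e) p q α β = begin
      block (pow A′ e · A′) p q α β
        ≡⟨ block-· (pow A′ e) A′ p q α β ⟩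
      ∑[ s < k ] (block (pow A′ e) p s · block A′ s q) α β
        ≡⟨ sum-cong-≗ {k} (λ s → trans
             (·-congʳ (block A′ s q) (block-pow-transposed e p s) α β)
             (·-congˡ (block (pow A e) s p) (transposed s q) α β)) ⟩
      ∑[ s < k ] (block (pow A e) s p · block A q s) α β
        ≡⟨ sum-cong-≗ {k} (λ s → Commute-block-pow A (λ p′ q′ → commuting p′ q′ q s) e s p α β) ⟩
      ∑[ s < k ] (block A q s · block (pow A e) s p) α β
        ≡⟨ block-· A (pow A e) q p α β ⟨
      -- Reversing the block factors has put A on the left, whereas `pow` appends it on the right.
      block (A · pow A e) q p α β
        ≡⟨ pow-comm A e (combine q α) (combine p β) ⟩
      block (pow A e · A) q p α β ∎

    tr-pow-transposed : ∀ e → tr (pow A e) ≡ tr (pow A′ e)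
    tr-pow-transposed e = begin
      tr (pow A e)                                     ≡⟨ ∑-combine k (λ x → pow A e x x) ⟩
      ∑[ p < k ] ∑[ α < m ] block (pow A e) p p α α
        ≡⟨ sum-cong-≗ {k} (λ p → sum-cong-≗ {m} (λ α → block-pow-transposed e p p α α)) ⟨
      ∑[ p < k ] ∑[ α < m ] block (pow A′ e) p p α α   ≡⟨ ∑-combine k (λ x → pow A′ e x x) ⟨
      tr (pow A′ e)                                    ∎

-- Adjacency blocks as integer matrices.

bit : Bool → ℤ
bit b = if b then 1ℤ else 0ℤ

bit-∧ : ∀ a b → bit (a ∧ b) ≡ bit a * bit b
bit-∧ true  true  = refl
bit-∧ true  false = refl
bit-∧ false true  = refl
bit-∧ false false = refl

bit-idBlock : ∀ {m} (α β : Fin m) → bit (idBlock α β) ≡ δ α β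
bit-idBlock α β with α ≟ β
... | yes refl = sym (δ-refl α)
... | no  α≢β  = sym (δ-≢ α≢β)

count-sum : ∀ {m} (f : Fin m → Bool) → + count f ≡ ∑[ γ < m ] bit (f γ)
count-sum {zero}  f = refl
count-sum {suc m} f with f zero
... | true  = cong (λ y → 1ℤ + y) (count-sum (f ∘ suc))
... | false = trans (count-sum (f ∘ suc)) (sym (ℤ.+-identityˡ _))

bits : ∀ {n m} → ClusterAdj n m → Fin n → Fin n → Matrix m
bits A i j α β = bit (A i j α β)

module _ {n m} (A : ClusterAdj n m) where

  -- Symmetry of the adjacency turns the second factor around, so an entry of a product of two
  -- blocks counts common neighbours; the commuting condition equates the counts for the two orders.
  Commute-bits : IsSimple A → CommutingCondition A → ∀ i j i′ j′ → Commute (bits A i j) (bits A i′ j′)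
  Commute-bits simple commuting i j i′ j′ α β = begin
    ∑[ γ < m ] (bits A i j α γ * bits A i′ j′ γ β)
      ≡⟨ sum-cong-≗ {m} (λ γ → trans
           (cong (λ b → bits A i j α γ * bit b) (proj₁ simple i′ j′ γ β))
           (sym (bit-∧ (A i j α γ) (A j′ i′ β γ)))) ⟩
    ∑[ γ < m ] bit (A i j α γ ∧ A j′ i′ β γ)
      ≡⟨ count-sum {m} (λ γ → A i j α γ ∧ A j′ i′ β γ) ⟨
    + count (λ γ → A i j α γ ∧ A j′ i′ β γ)
      ≡⟨ cong +_ (commuting i j i′ j′ α β) ⟩
    + count (λ γ → A j i β γ ∧ A i′ j′ α γ)
      ≡⟨ count-sum {m} (λ γ → A j i β γ ∧ A i′ j′ α γ) ⟩
    ∑[ γ < m ] bit (A j i β γ ∧ A i′ j′ α γ)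
      ≡⟨ sum-cong-≗ {m} (λ γ → begin
           bit (A j i β γ ∧ A i′ j′ α γ)     ≡⟨ bit-∧ (A j i β γ) (A i′ j′ α γ) ⟩
           bits A j i β γ * bits A i′ j′ α γ ≡⟨ ℤ.*-comm (bits A j i β γ) (bits A i′ j′ α γ) ⟩
           bits A i′ j′ α γ * bits A j i β γ
             ≡⟨ cong (λ b → bits A i′ j′ α γ * bit b) (proj₁ simple j i β γ) ⟩
           bits A i′ j′ α γ * bits A i j γ β ∎) ⟩
    ∑[ γ < m ] (bits A i′ j′ α γ * bits A i j γ β) ∎

  -- One form for all blocks of `H`: the last alternative includes i = j, which is where the
  -- diagonal blocks fall.
  Admissible : Matrix m → Set
  Admissible B =
    (∀ α β → B α β ≡ δ α β) ⊎ (∀ α β → B α β ≡ 0ℤ) ⊎ ∃₂ λ i j → ∀ α β → B α β ≡ bits A i j α β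

  Commute-Admissible : IsSimple A → CommutingCondition A → ∀ B C → Admissible B → Admissible C → Commute B C
  Commute-Admissible _ _ B C (inj₁ B≗I) _ = Commute-resp B≗I (λ _ _ → refl) (Commute-I C)
  Commute-Admissible _ _ B C (inj₂ (inj₁ B≗0)) _ = Commute-resp B≗0 (λ _ _ → refl) (Commute-0 C)
  Commute-Admissible _ _ B C (inj₂ (inj₂ _)) (inj₁ C≗I) r c =
    sym (Commute-resp {C = B} C≗I (λ _ _ → refl) (Commute-I B) r c)
  Commute-Admissible _ _ B C (inj₂ (inj₂ _)) (inj₂ (inj₁ C≗0)) r c =
    sym (Commute-resp {C = B} C≗0 (λ _ _ → refl) (Commute-0 B) r c)
  Commute-Admissible simple commuting B C (inj₂ (inj₂ (i , j , B≗))) (inj₂ (inj₂ (i′ , j′ , C≗))) =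
    Commute-resp B≗ C≗ (Commute-bits simple commuting i j i′ j′)

  BuiltFrom⇒Admissible : ∀ {k} {H : ClusterAdj k m} → BuiltFrom A H → ∀ p q → Admissible (bits H p q)
  BuiltFrom⇒Admissible (diagonal , offDiagonal) p q with p ≟ q
  ... | yes refl with i , eq ← diagonal p = inj₂ (inj₂ (i , i , λ α β → cong bit (eq α β)))
  ... | no p≢q with offDiagonal p q p≢q
  ...   | inj₁ eq = inj₁ (λ α β → trans (cong bit (eq α β)) (bit-idBlock α β))
  ...   | inj₂ (inj₁ eq) = inj₂ (inj₁ (λ α β → cong bit (eq α β)))
  ...   | inj₂ (inj₂ (i , j , _ , eq)) = inj₂ (inj₂ (i , j , λ α β → cong bit (eq α β)))

-- Coefficients of the characteristic polynomial

coeff-+P : ∀ p q i → coeff (p +P q) i ≡ coeff p i + coeff q i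
coeff-+P []      q       i       = sym (ℤ.+-identityˡ _)
coeff-+P (a ∷ p) []      i       = sym (ℤ.+-identityʳ _)
coeff-+P (a ∷ p) (b ∷ q) zero    = refl
coeff-+P (a ∷ p) (b ∷ q) (suc i) = coeff-+P p q i

coeff-map : ∀ (f : ℤ → ℤ) → f 0ℤ ≡ 0ℤ → ∀ p i → coeff (map f p) i ≡ f (coeff p i)
coeff-map f f0≡0 []      i       = sym f0≡0
coeff-map f f0≡0 (a ∷ p) zero    = refl
coeff-map f f0≡0 (a ∷ p) (suc i) = coeff-map f f0≡0 p i

coeff-*P : ∀ p q i → coeff (p *P q) i ≡ (coeff p ⊛ coeff q) i
coeff-*P []      q i = sym (0-⊛ (coeff q) i)
coeff-*P (a ∷ p) q i =
  trans (coeff-+P (map (a *_) q) _ i)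
    (trans (cong (_+ coeff (0ℤ ∷ p *P q) i) (coeff-map (a *_) (ℤ.*-zeroʳ a) q i)) (shift i))
  where
  shift : ∀ i → a * coeff q i + coeff (0ℤ ∷ p *P q) i ≡ (coeff (a ∷ p) ⊛ coeff q) i
  shift zero    = ℤ.+-identityʳ _
  shift (suc i) = cong (λ y → a * coeff q (suc i) + y) (coeff-*P p q i)

-- Reconciles two sign conventions: `sumFin` negates each later summand, whereas `alt` subtracts
-- their alternating sum.
alt-neg : ∀ {n} (f : Fin n → ℤ) → ℤDet.alt (λ j → - f j) ≡ - ℤDet.alt f
alt-neg f = begin
  ℤDet.alt (λ j → - f j)           ≡⟨ ℤDet.alt-cong (λ j → ℤ.-1*i≡-i (f j)) ⟨
  ℤDet.alt (λ j → - 1ℤ * f j)      ≡⟨ ℤDet.alt-* (- 1ℤ) f ⟩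
  - 1ℤ * ℤDet.alt f                ≡⟨ ℤ.-1*i≡-i _ ⟩
  - ℤDet.alt f                     ∎

coeff-sumFin : ∀ {n} (f : Fin n → Poly) i → coeff (sumFin f) i ≡ ℤDet.alt (λ j → coeff (f j) i)
coeff-sumFin {zero}  f i = sym (ℤDet.alt-[] _)
coeff-sumFin {suc n} f i = begin
  coeff (f zero +P sumFin (λ j → negP (f (suc j)))) i
    ≡⟨ coeff-+P (f zero) _ i ⟩
  coeff (f zero) i + coeff (sumFin (λ j → negP (f (suc j)))) i
    ≡⟨ cong (λ y → coeff (f zero) i + y) (trans (coeff-sumFin (λ j → negP (f (suc j))) i)
         (trans (ℤDet.alt-cong (λ j → coeff-map -_ refl (f (suc j)) i)) (alt-neg _))) ⟩
  coeff (f zero) i - ℤDet.alt (λ j → coeff (f (suc j)) i)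
    ≡⟨ ℤDet.alt-∷ _ ⟨
  ℤDet.alt (λ j → coeff (f j) i) ∎

coeff-det : ∀ N (M : Fin N → Fin N → Poly) →
  coeff (det N M) ≗ SDet.determinant N (λ r c → coeff (M r c))
coeff-det zero    M zero    = refl
coeff-det zero    M (suc i) = refl
coeff-det (suc N) M i = begin
  coeff (sumFin (λ j → M zero j *P det N (λ r c → M (suc r) (punchIn j c)))) i
    ≡⟨ coeff-sumFin (λ j → M zero j *P det N (λ r c → M (suc r) (punchIn j c))) i ⟩
  ℤDet.alt (λ j → coeff (M zero j *P det N (λ r c → M (suc r) (punchIn j c))) i)
    ≡⟨ ℤDet.alt-cong (λ j → trans (coeff-*P (M zero j) _ i)
         (⊛-cong {f = coeff (M zero j)} (λ _ → refl) (coeff-det N (λ r c → M (suc r) (punchIn j c))) i)) ⟩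
  ℤDet.alt (λ j → (coeff (M zero j) ⊛ SDet.determinant N (λ r c → coeff (M (suc r) (punchIn j c)))) i)
    ≡⟨ alt-coeff _ i ⟨
  SDet.determinant (suc N) (λ r c → coeff (M r c)) i ∎

coeff-entry : ∀ {N} (r c : Fin N) a i →
  coeff (if does (r ≟ c) then (- a) ∷ 1ℤ ∷ [] else (- a) ∷ []) i ≡ ((X ⊛ SDet.δ r c) ⊕ (⊖ constant a)) i
coeff-entry r c a zero with does (r ≟ c)
... | true  = sym (ℤ.+-identityˡ _)
... | false = sym (ℤ.+-identityˡ _)
coeff-entry r c a (suc i) =
  trans (linear i) (sym (trans (ℤ.+-identityʳ _) (X-⊛ (SDet.δ r c) i)))
  where
  linear : ∀ i →
    coeff (if does (r ≟ c) then (- a) ∷ 1ℤ ∷ [] else (- a) ∷ []) (suc i) ≡ SDet.δ r c i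
  linear i with r ≟ c
  linear zero    | yes refl = cong (λ f → f 0) (sym (SDet.δ-refl r))
  linear (suc i) | yes refl = cong (λ f → f (suc i)) (sym (SDet.δ-refl r))
  linear i       | no  r≢c  = cong (λ f → f i) (sym (SDet.δ-≢ r≢c))

coeff-charPoly : ∀ N (B : Fin N → Fin N → Bool) →
  coeff (charPoly N B) ≗ Characteristic.p (λ r c → bit (B r c))
coeff-charPoly N B i = trans (coeff-det N _ i)
  (SDet.det-cong N (λ r c → coeff-entry r c (bit (B r c))) i)

flatten-combine : ∀ {k m} (H : ClusterAdj k m) p q α β →
  flatten H (combine p α) (combine q β) ≡ H p q α β
flatten-combine {k} {m} H p q α β =
  cong₂ (λ (p , α) (q , β) → H p q α β) (remQuot-combine {k} p α) (remQuot-combine {k} q β)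

theorem8 : (n m k : ℕ) (A : ClusterAdj n m) (H : ClusterAdj k m) →
    IsSimple A → CommutingCondition A → NormalityCondition A →
    k ≥ 2 → IsSimple H → BuiltFrom A H →
    Cospectral H (partialTranspose H)
theorem8 n m k A H simpleA commuting _ _ simpleH built i = begin
  coeff (charPoly (k ℕ.* m) (flatten H)) i
    ≡⟨ coeff-charPoly (k ℕ.* m) (flatten H) i ⟩
  Characteristic.p F i
    ≡⟨ characteristic-unique F Fᵗ (tr-pow-transposed F Fᵗ transposed commute) i ⟩
  Characteristic.p Fᵗ i
    ≡⟨ coeff-charPoly (k ℕ.* m) (flatten (partialTranspose H)) i ⟨
  coeff (charPoly (k ℕ.* m) (flatten (partialTranspose H))) i ∎
  where
  open Blocks k m

  F Fᵗ : Matrix (k ℕ.* m)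
  F  x y = bit (flatten H x y)
  Fᵗ x y = bit (flatten (partialTranspose H) x y)

  transposed : ∀ p q α β → block Fᵗ p q α β ≡ block F q p α β
  transposed p q α β = cong bit (begin
    flatten (partialTranspose H) (combine p α) (combine q β)
      ≡⟨ flatten-combine (partialTranspose H) p q α β ⟩
    -- Symmetry of `H` turns transposition inside a block into a move of the block.
    H p q β α                                ≡⟨ proj₁ simpleH p q β α ⟩
    H q p α β                                ≡⟨ flatten-combine H q p α β ⟨
    flatten H (combine q α) (combine p β)    ∎)

  commute : ∀ p q s t → Commute (block F p q) (block F s t)
  commute p q s t = Commute-resp
    (λ α β → cong bit (flatten-combine H p q α β))
    (λ α β → cong bit (flatten-combine H s t α β))
    (Commute-Admissible A simpleA commuting _ _
      (BuiltFrom⇒Admissible A built p q)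
      (BuiltFrom⇒Admissible A built s t))
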